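{- If a graph $G$ is bipartite and consists of $k$ components, then $G$ is critically $k$-uniform.
   Context: $[k]=\{1,\dots,k\}$ and $\chi(G)$ is the chromatic number of a graph $G=(V,E)$. For a proper vertex coloring $c:V\to[\chi(G)]$, a determining set for $(G,c)$ is a set $S\subseteq V$ such that for every proper vertex coloring $c':V\to[\chi(G)]$ of $G$, if $c'|_S=c|_S$ then $c'=c$ on all of $V$. A critical set for $(G,c)$ is a determining set for $(G,c)$ that is minimal under inclusion. $G$ is critically $k$-uniform if every critical set $S\subset V$ (for any proper coloring $c:V\to[\chi(G)]$) satisfies $|S|=k$. Components are connected components.
   Formalization: The formal statement adds that the chromatic number of G is not 1, which excludes exactly the nonempty edgeless graphs, where the claim fails (the only critical set is empty although k ≥ 1); graphs are finite and simple. -}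

module Defs where

open import Data.Fin using (Fin; finToFun; funToFin)
open import Data.Fin.Properties using (_≟_; all?; any?; finToFun-funToFin)
open import Data.Fin.Subset using (Subset; _∈_; _∉_; _⊂_; ∣_∣)
open import Data.Nat using (ℕ; zero; suc; _≤_; z≤n; s≤s)
open import Data.Product using (∃; _×_; _,_; proj₁; proj₂)
open import Data.Sum using (_⊎_)
open import Function using (_∘_; id)
open import Function.Bundles using (Bijection)
open import Level using (0ℓ)
open import Relation.Binary using (Rel; Symmetric; Irreflexive; Decidable; Setoid)
open import Relation.Binary.Construct.Closure.ReflexiveTransitive
  using (Star; ε; _◅◅_; reverse)
open import Relation.Binary.PropositionalEquality
  using (_≡_; _≢_; _≗_; refl; sym; trans; setoid)
open import Relation.Nullary using (¬_; Dec; yes; no; contradiction; ¬?; _→-dec_)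
open import Relation.Nullary.Decidable using (map′)
import Relation.Unary as U

-- Finite simple graphs on the vertex set Fin n.
record Graph (n : ℕ) : Set₁ where
  infix 4 _~_
  field
    _~_      : Rel (Fin n) 0ℓ
    ~-sym    : Symmetric _~_
    ~-irrefl : Irreflexive _≡_ _~_
    _~?_     : Decidable _~_

module _ {n : ℕ} (G : Graph n) where
  open Graph G

  Proper : {q : ℕ} → (Fin n → Fin q) → Set
  Proper c = ∀ u v → u ~ v → c u ≢ c v

  Colorable : ℕ → Set
  Colorable q = ∃ λ (c : Fin n → Fin q) → Proper c

  proper? : {q : ℕ} → U.Decidable (Proper {q})
  proper? c = all? λ u → all? λ v → (u ~? v) →-dec ¬? (c u ≟ c v)

  colorable? : U.Decidable Colorable
  colorable? q = map′
    (λ (i , p) → finToFun i , p)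
    (λ (c , p) → funToFin c , λ u v e eq →
      p u v e (trans (sym (finToFun-funToFin c u))
                     (trans eq (finToFun-funToFin c v))))
    (any? λ i → proper? (finToFun {q} {n} i))

  n-colorable : Colorable n
  n-colorable = id , λ u v e u≡v → ~-irrefl u≡v e

least : {P : ℕ → Set} → U.Decidable P → ∀ m → P m →
        ∃ λ q → P q × (∀ r → P r → q ≤ r)
least P? zero    p = zero , p , λ _ _ → z≤n
least P? (suc m) p with P? zero
... | yes p₀ = zero , p₀ , λ _ _ → z≤n
... | no ¬p₀ with least (P? ∘ suc) m p
...   | q , pq , min = suc q , pq , λ where
          zero    p₀ → contradiction p₀ ¬p₀
          (suc r) pr → s≤s (min r pr)

module _ {n : ℕ} (G : Graph n) where
  open Graph G

  chromaticNumber : ∃ λ q → Colorable G q × (∀ r → Colorable G r → q ≤ r)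
  chromaticNumber = least (colorable? G) n (n-colorable G)

  χ : ℕ
  χ = proj₁ chromaticNumber

  χ-colorable : Colorable G χ
  χ-colorable = proj₁ (proj₂ chromaticNumber)

  χ-minimal : ∀ r → Colorable G r → χ ≤ r
  χ-minimal = proj₂ (proj₂ chromaticNumber)

  -- The two parts are A and its complement; either may be empty.
  Bipartite : Set
  Bipartite = ∃ λ (A : Subset n) →
    ∀ u v → u ~ v → (u ∈ A × v ∉ A) ⊎ (u ∉ A × v ∈ A)

  -- Vertices up to being joined by a walk, so that the elements of this
  -- setoid are the connected components.
  Components : Setoid 0ℓ 0ℓ
  Components = record
    { Carrier       = Fin n
    ; _≈_           = Star _~_
    ; isEquivalence = record { refl = ε ; sym = reverse ~-sym ; trans = _◅◅_ }
    }

  HasComponents : ℕ → Set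
  HasComponents k = Bijection Components (setoid (Fin k))

  Determining : (Fin n → Fin χ) → Subset n → Set
  Determining c S = ∀ (c′ : Fin n → Fin χ) → Proper G c′ →
    (∀ v → v ∈ S → c′ v ≡ c v) → c′ ≗ c

  Critical : (Fin n → Fin χ) → Subset n → Set
  Critical c S = Determining c S × (∀ T → T ⊂ S → ¬ Determining c T)

  CriticallyUniform : ℕ → Set
  CriticallyUniform k =
    ∀ (c : Fin n → Fin χ) → Proper G c → ∀ S → Critical c S → ∣ S ∣ ≡ k

{-# OPTIONS --safe #-}

-- With two colours, a proper colouring is fixed on a component by its value at
-- any one vertex, while swapping the colours on a component that S misses gives
-- another proper colouring. So S is determining iff it meets every component,
-- and critical iff it meets each of them exactly once.
module Submission where

open import Data.Bool using (true; false; if_then_else_)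
open import Data.Fin using (Fin; zero; suc; opposite)
open import Data.Fin.Properties
  using (_≟_; any?; cantor-schröder-bernstein; opposite-involutive; suc-injective)
open import Data.Fin.Subset using (Subset; _∈_; _-_; ∣_∣)
open import Data.Fin.Subset.Properties using (_∈?_; x∈p⇒p-x⊂p; x∈p∧x≢y⇒x∈p-y)
open import Data.Nat using (ℕ; _≤_; z≤n; s≤s)
open import Data.Product using (∃; _×_; _,_; proj₁; proj₂)
open import Data.Sum using (inj₁; inj₂)
open import Data.Vec using (_∷_; here; there)
open import Function using (_∘_)
open import Function.Bundles using (Bijection)
open import Function.Definitions using (Injective)
open import Relation.Binary.Construct.Closure.ReflexiveTransitive
  using (Star; ε; _◅_)
open import Relation.Binary.PropositionalEquality
  using (_≡_; _≢_; refl; sym; trans; cong)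
open import Relation.Nullary using (yes; no; does; contradiction; _×-dec_)
open import Relation.Nullary.Decidable using (decidable-stable)
open import Defs

-- The increasing enumeration of `S`. It turns the number `∣ S ∣` into an index type, so that
-- cardinalities can be compared through maps between finite types.
nth : ∀ {n} (S : Subset n) → Fin ∣ S ∣ → Fin n
nth (true  ∷ S) zero    = zero
nth (true  ∷ S) (suc j) = suc (nth S j)
nth (false ∷ S) j       = suc (nth S j)

nth-∈ : ∀ {n} (S : Subset n) j → nth S j ∈ S
nth-∈ (true  ∷ S) zero    = here
nth-∈ (true  ∷ S) (suc j) = there (nth-∈ S j)
nth-∈ (false ∷ S) j       = there (nth-∈ S j)

nth-injective : ∀ {n} (S : Subset n) → Injective _≡_ _≡_ (nth S)
nth-injective (true  ∷ S) {zero}  {zero}  eq = refl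
nth-injective (true  ∷ S) {suc i} {suc j} eq =
  cong suc (nth-injective S (suc-injective eq))
nth-injective (false ∷ S) eq = nth-injective S (suc-injective eq)

nth-surjective : ∀ {n} (S : Subset n) {v} → v ∈ S → ∃ λ j → nth S j ≡ v
nth-surjective (true ∷ S) here = zero , refl
nth-surjective (true ∷ S) (there v∈S) with nth-surjective S v∈S
... | j , refl = suc j , refl
nth-surjective (false ∷ S) (there v∈S) with nth-surjective S v∈S
... | j , refl = j , refl

-- `f ∘ nth S` injects `Fin ∣ S ∣` into `Fin k`. Choosing an element of `S` over each `i` gives an
-- injection back, because `f` recovers `i` from the choice.
∣∣-bijectiveOn : ∀ {n k} (S : Subset n) (f : Fin n → Fin k) →
  (∀ {u v} → u ∈ S → v ∈ S → f u ≡ f v → u ≡ v) →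
  (∀ i → ∃ λ v → v ∈ S × f v ≡ i) →
  ∣ S ∣ ≡ k
∣∣-bijectiveOn {k = k} S f inj surj = cantor-schröder-bernstein
  {f = f ∘ nth S} {g = position}
  (λ eq → nth-injective S (inj (nth-∈ S _) (nth-∈ S _) eq))
  (λ {i} {j} eq → trans (sym (f-position i)) (trans (cong (f ∘ nth S) eq) (f-position j)))
  where
  position : Fin k → Fin ∣ S ∣
  position i = proj₁ (nth-surjective S (proj₁ (proj₂ (surj i))))

  f-position : ∀ i → f (nth S (position i)) ≡ i
  f-position i with surj i
  ... | v , v∈S , fv≡i = trans (cong f (proj₂ (nth-surjective S v∈S))) fv≡i

-- On two colours `opposite` is the swap. A single colour would be its own opposite, hence `q ≢ 1`.
opposite-≢ : ∀ {q} → q ≤ 2 → q ≢ 1 → (x : Fin q) → opposite x ≢ x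
opposite-≢ (s≤s z≤n)       q≢1 zero       = contradiction refl q≢1
opposite-≢ (s≤s (s≤s z≤n)) _   zero       ()
opposite-≢ (s≤s (s≤s z≤n)) _   (suc zero) ()

opposite-injective : ∀ {q} → Injective _≡_ _≡_ (opposite {q})
opposite-injective {x = x} {y} eq =
  trans (sym (opposite-involutive x)) (trans (cong opposite eq) (opposite-involutive y))

≢-≢⇒≡ : ∀ {q} → q ≤ 2 → {x y z : Fin q} → x ≢ z → y ≢ z → x ≡ y
≢-≢⇒≡ (s≤s z≤n)       {zero}     {zero}               _   _   = refl
≢-≢⇒≡ (s≤s (s≤s z≤n)) {zero}     {zero}               _   _   = refl
≢-≢⇒≡ (s≤s (s≤s z≤n)) {suc zero} {suc zero}           _   _   = refl
≢-≢⇒≡ (s≤s (s≤s z≤n)) {zero}     {suc zero} {zero}     x≢z _   = contradiction refl x≢z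
≢-≢⇒≡ (s≤s (s≤s z≤n)) {zero}     {suc zero} {suc zero} _   y≢z = contradiction refl y≢z
≢-≢⇒≡ (s≤s (s≤s z≤n)) {suc zero} {zero}     {zero}     _   y≢z = contradiction refl y≢z
≢-≢⇒≡ (s≤s (s≤s z≤n)) {suc zero} {zero}     {suc zero} x≢z _   = contradiction refl x≢z

module _ {n : ℕ} (G : Graph n) where
  open Graph G

  bipartite⇒2-colorable : Bipartite G → Colorable G 2
  bipartite⇒2-colorable (A , cross) = color , proper
    where
    color : Fin n → Fin 2
    color v = if does (v ∈? A) then zero else suc zero

    proper : Proper G color
    proper u v u~v eq with u ∈? A | v ∈? A | cross u v u~v
    ... | yes _   | yes v∈A | inj₁ (_ , v∉A) = v∉A v∈A
    ... | yes u∈A | yes _   | inj₂ (u∉A , _) = u∉A u∈A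
    ... | no u∉A  | no _    | inj₁ (u∈A , _) = u∉A u∈A
    ... | no _    | no v∉A  | inj₂ (_ , v∈A) = v∉A v∈A

  -- Along an edge from `u` to `w`, agreement at `u` means that `c w` and `c′ w` both avoid the
  -- colour `c u`. At most one other colour is left, so they agree at `w` too.
  walk-agree : ∀ {q} → q ≤ 2 → {c c′ : Fin n → Fin q} → Proper G c → Proper G c′ →
    ∀ {u v} → Star _~_ u v → c′ u ≡ c u → c′ v ≡ c v
  walk-agree q≤2 pc pc′ ε eq = eq
  walk-agree q≤2 {c} {c′} pc pc′ (_◅_ {u} {w} u~w w⇝v) eq =
    walk-agree q≤2 pc pc′ w⇝v
      (≢-≢⇒≡ q≤2 (λ c′w≡cu → pc′ u w u~w (trans eq (sym c′w≡cu))) (pc w u (~-sym u~w)))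

  module _ {k : ℕ} (components : HasComponents G k) (χ≤2 : χ G ≤ 2)
           (c : Fin n → Fin (χ G)) (proper : Proper G c) where
    open Bijection components using (injective; surjective)
      renaming (to to component; cong to component-cong)

    MeetsAll : Subset n → Set
    MeetsAll S = ∀ i → ∃ λ v → v ∈ S × component v ≡ i

    meetsAll⇒determining : ∀ {S} → MeetsAll S → Determining G c S
    meetsAll⇒determining meets c′ proper′ agree u with meets (component u)
    -- Equality in `Components` is being joined by a walk, so `injective` turns equal labels into a
    -- walk from `v` to `u`.
    ... | v , v∈S , eq = walk-agree χ≤2 proper proper′ (injective eq) (agree v v∈S)

    swapOn : Fin k → Fin n → Fin (χ G)
    swapOn i v = if does (component v ≟ i) then opposite (c v) else c v

    swapOn-proper : ∀ i → Proper G (swapOn i)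
    swapOn-proper i u v u~v eq
      -- The one-edge walk gives both ends the same label, so an edge with exactly one swapped end
      -- cannot occur.
      with component u ≟ i | component v ≟ i | component-cong (u~v ◅ ε)
    ... | yes _   | yes _   | _    = proper u v u~v (opposite-injective eq)
    ... | no _    | no _    | _    = proper u v u~v eq
    ... | yes u∈i | no v∉i  | same = v∉i (trans (sym same) u∈i)
    ... | no u∉i  | yes v∈i | same = u∉i (trans same v∈i)

    swapOn-outside : ∀ {i v} → component v ≢ i → swapOn i v ≡ c v
    swapOn-outside {i} {v} v∉i with component v ≟ i
    ... | yes v∈i = contradiction v∈i v∉i
    ... | no _    = refl

    swapOn-inside : ∀ {i v} → component v ≡ i → swapOn i v ≡ opposite (c v)
    swapOn-inside {i} {v} v∈i with component v ≟ i
    ... | yes _   = refl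
    ... | no v∉i  = contradiction v∈i v∉i

    -- If `S` misses component `i`, then `swapOn i` agrees with `c` on `S`, yet differs from it at
    -- any vertex of that component.
    determining⇒meetsAll : χ G ≢ 1 → ∀ {S} → Determining G c S → MeetsAll S
    determining⇒meetsAll χ≢1 {S} det i
      with any? (λ v → (v ∈? S) ×-dec (component v ≟ i))
    ... | yes meets = meets
    ... | no misses = contradiction
      (trans (sym (swapOn-inside (v∈i ε)))
        (det (swapOn i) (swapOn-proper i)
          (λ w w∈S → swapOn-outside (λ w∈i → misses (w , w∈S , w∈i))) v))
      (opposite-≢ χ≤2 χ≢1 (c v))
      where
      v = proj₁ (surjective i)
      -- `surjective` gives the label of every vertex joined to `v`; the empty walk `ε` selects `v`
      -- itself.
      v∈i : ∀ {z} → Star _~_ z v → component z ≡ i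
      v∈i = proj₂ (surjective i)

    meetsAll-remove : ∀ {S u v} → u ∈ S → u ≢ v → component u ≡ component v →
      MeetsAll S → MeetsAll (S - v)
    meetsAll-remove {S} {u} {v} u∈S u≢v same meets i with meets i
    ... | w , w∈S , w∈i with w ≟ v
    ...   | no w≢v   = w , x∈p∧x≢y⇒x∈p-y w∈S w≢v , w∈i
    -- When the removed vertex was the representative, `u` from the same component replaces it.
    ...   | yes refl = u , x∈p∧x≢y⇒x∈p-y u∈S u≢v , trans same w∈i

    -- Of two elements of `S` in one component, one can be deleted and every component is still met,
    -- so a smaller set is determining, against minimality.
    critical⇒injectiveOn : χ G ≢ 1 → ∀ {S} → Critical G c S →
      ∀ {u v} → u ∈ S → v ∈ S → component u ≡ component v → u ≡ v
    critical⇒injectiveOn χ≢1 {S} (det , minimal) {u} {v} u∈S v∈S same =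
      decidable-stable (u ≟ v) λ u≢v →
        minimal (S - v) (x∈p⇒p-x⊂p v∈S)
          (meetsAll⇒determining
            (meetsAll-remove u∈S u≢v same (determining⇒meetsAll χ≢1 det)))

-- The condition `χ G ≢ 1` rules out nonempty edgeless graphs: these have only one proper colouring
-- with `χ G` colours, so their only critical set is empty although they have components.
corollary2 : ∀ {n : ℕ} (G : Graph n) (k : ℕ) →
    Bipartite G → χ G ≢ 1 → HasComponents G k → CriticallyUniform G k
corollary2 G k bipartite χ≢1 components c proper S critical =
  ∣∣-bijectiveOn S (Bijection.to components)
    (critical⇒injectiveOn G components χ≤2 c proper χ≢1 critical)
    (determining⇒meetsAll G components χ≤2 c proper χ≢1 (proj₁ critical))
  where
  χ≤2 : χ G ≤ 2
  -- Only an upper bound is available, since the graph without vertices has `χ G ≡ 0`; the colour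
  -- lemmas therefore assume at most two colours.
  χ≤2 = χ-minimal G 2 (bipartite⇒2-colorable G bipartite)
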